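{- Let $p$ be an odd prime, $\mathbb V=\mathbb V(3,p)$ the space of row vectors of length 3 over $\mathrm{GF}(p)$, and $G=\mathrm{GL}(3,p)$ acting on $\mathbb V$ by right multiplication. Let $$x=\begin{pmatrix}1&2&2\\0&1&2\\0&0&1\end{pmatrix}\in G.$$ Then: (1) $x$ fixes setwise exactly one 1-dimensional subspace, namely $\langle\alpha\rangle$ with $\alpha=(0,0,1)$, and exactly one 2-dimensional subspace, namely $\mathbb S'=\{(0,a_2,a_3):a_2,a_3\in\mathrm{GF}(p)\}$. (2) For every 2-dimensional subspace $\mathbb S$ of $\mathbb V$ with $\alpha\notin\mathbb S$, and all pairwise distinct $i,j,k\in\mathrm{GF}(p)$, one has $\mathbb S^{x^i}\cap\mathbb S^{x^j}\cap\mathbb S^{x^k}=\{0\}$. -}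

module Defs where

open import Data.Nat as ℕ using (ℕ; zero; suc; NonZero)
open import Data.Nat.DivMod using (_mod_)
open import Data.Fin using (Fin; toℕ)
open import Data.Vec using (Vec; []; _∷_; zipWith; replicate; map)
open import Data.Product using (Σ; ∃; ∃₂; _×_; _,_)
open import Relation.Binary.PropositionalEquality using (_≡_; _≢_)

module _ (p : ℕ) .{{_ : NonZero p}} where

  F : Set
  F = Fin p

  _+F_ : F → F → F
  a +F b = (toℕ a ℕ.+ toℕ b) mod p

  _*F_ : F → F → F
  a *F b = (toℕ a ℕ.* toℕ b) mod p

  0F 1F 2F : F
  0F = 0 mod p
  1F = 1 mod p
  2F = 2 mod p

  V : Set
  V = Vec F 3

  0V : V
  0V = replicate 3 0F

  _+V_ : ∀ {n} → Vec F n → Vec F n → Vec F n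
  _+V_ = zipWith _+F_

  _·V_ : ∀ {n} → F → Vec F n → Vec F n
  c ·V v = map (c *F_) v

  -- 3×3 matrices, as a vector of rows
  Mat : Set
  Mat = Vec V 3

  vecMat : ∀ {n} → Vec F n → Vec V n → V
  vecMat []       []       = 0V
  vecMat (c ∷ cs) (r ∷ rs) = (c ·V r) +V vecMat cs rs

  matMul : Mat → Mat → Mat
  matMul A B = map (λ r → vecMat r B) A

  I3 : Mat
  I3 = (1F ∷ 0F ∷ 0F ∷ [])
     ∷ (0F ∷ 1F ∷ 0F ∷ [])
     ∷ (0F ∷ 0F ∷ 1F ∷ [])
     ∷ []

  mpow : Mat → ℕ → Mat
  mpow M zero    = I3
  mpow M (suc n) = matMul (mpow M n) M

  xMat : Mat
  xMat = (1F ∷ 2F ∷ 2F ∷ [])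
       ∷ (0F ∷ 1F ∷ 2F ∷ [])
       ∷ (0F ∷ 0F ∷ 1F ∷ [])
       ∷ []

  α : V
  α = 0F ∷ 0F ∷ 1F ∷ []

  VSet : Set₁
  VSet = V → Set

  _≐_ : VSet → VSet → Set
  A ≐ B = ∀ w → (A w → B w) × (B w → A w)

  image : Mat → VSet → VSet
  image g S w = Σ V λ u → S u × (w ≡ vecMat u g)

  Fixes : Mat → VSet → Set
  Fixes g S = image g S ≐ S

  span1 : V → VSet
  span1 v w = Σ F λ c → w ≡ c ·V v

  span2 : V → V → VSet
  span2 u v w = Σ F λ a → Σ F λ b → w ≡ (a ·V u) +V (b ·V v)

  LinIndep2 : V → V → Set
  LinIndep2 u v = ∀ a b → (a ·V u) +V (b ·V v) ≡ 0V → (a ≡ 0F) × (b ≡ 0F)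

  Dim1 : VSet → Set
  Dim1 S = Σ V λ v → (v ≢ 0V) × (S ≐ span1 v)

  Dim2 : VSet → Set
  Dim2 S = Σ V λ u → Σ V λ v → LinIndep2 u v × (S ≐ span2 u v)

  S' : VSet
  S' w = Σ F λ a₂ → Σ F λ a₃ → w ≡ 0F ∷ a₂ ∷ a₃ ∷ []

  Zero : VSet
  Zero w = w ≡ 0V

  _∩_ : VSet → VSet → VSet
  (A ∩ B) w = A w × B w

-- Arithmetic in GF(p) is done on integer representatives, so each step is a polynomial
-- identity over ℤ combined with divisibility by p of the quantities it involves.
--
-- Over ℤ the powers of x are X t = [[1,2t,2t²],[0,1,2t],[0,0,1]], and X t · X (−t) = 1.
-- A plane S spanned by u and v lies in the kernel of w ↦ w · n for n = u × v, so a vector w of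
-- S^(x^t) satisfies (w X(−t)) · n = (w · n) − 2 (w₁n₂ + w₂n₃) t + 2 w₁n₃ t² ≡ 0.
--  * If α ∉ S then n₃ ≢ 0.  A quadratic with three distinct roots vanishes, and the vanishing
--    of its coefficients is a triangular system in w with diagonal n₃, so w = 0.
--  * If x fixes S, comparing t = 0 with t = 1 at w = u and w = v gives 2n₃² ≡ 0 and then
--    2n₂² ≡ 0; hence n is a multiple of e₁ and S = S' (Cramer's rule gives S' ⊆ S).
--  * If x fixes a line ⟨v⟩ then v X 1 = c v, which forces 2v₁² ≡ 0 and 2v₂² ≡ 0, so ⟨v⟩ = ⟨α⟩.
-- The oddness of p is used only to cancel these factors 2.

module Submission where

open import Defs
open import Data.Nat using (ℕ; NonZero; _%_)
open import Data.Nat.Primality using (Prime)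
open import Data.Fin using (Fin; toℕ)
open import Data.Product using (_×_)
open import Relation.Binary.PropositionalEquality using (_≡_; _≢_)
open import Relation.Nullary using (¬_)

open import Data.Fin using (fromℕ<)
open import Data.Fin.Properties using (toℕ-fromℕ<; toℕ-injective; toℕ<n)
open import Data.Integer using (ℤ; +_; _+_; _*_; _-_; -_; _%ℕ_; _/ℕ_)
open import Data.Integer using () renaming (∣_∣ to abs)
open import Data.Integer.DivMod using (n%ℕd<d; a≡a%ℕn+[a/ℕn]*n)
open import Data.Integer.Divisibility.Signed
  using (_∣_; divides; ∣-refl; ∣m∣n⇒∣m+n; ∣m∣n⇒∣m-n; ∣n⇒∣m*n; ∣m⇒∣m*n; ∣m⇒∣-m; ∣⇒∣ᵤ; ∣ᵤ⇒∣)
import Data.Integer.Properties as ℤ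
open import Data.Integer.Tactic.RingSolver using (solve-∀)
import Data.Nat as ℕ
import Data.Nat.Properties as ℕ
import Data.Nat.Divisibility as ℕ
import Data.Nat.DivMod as ℕ
open import Data.Nat.Primality using (prime; prime⇒nonZero; euclidsLemma; irreducible[2])
open import Data.Nat.Coprimality using (prime⇒coprime; coprime-Bézout)
open import Data.Nat.GCD using (module Bézout)
open import Data.Product using (Σ; _,_; proj₁; proj₂)
open import Data.Sum using (_⊎_; inj₁; inj₂)
open import Data.Vec using ([]; _∷_)
open import Relation.Binary.PropositionalEquality using (refl; sym; trans; cong; cong₂; subst; module ≡-Reasoning)
open import Relation.Nullary using (Dec; yes; no; contradiction)
open import Relation.Nullary.Decidable using (map′)

prime∤1 : ∀ {p} → Prime p → ¬ p ℕ.∣ 1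
prime∤1 (prime _) p∣1 = ℕ.nonTrivial⇒≢1 (ℕ.∣1⇒≡1 p∣1)

odd-prime∤2 : ∀ {p} → Prime p → p % 2 ≡ 1 → ¬ p ℕ.∣ 2
odd-prime∤2 p-prime p-odd p∣2 with irreducible[2] p∣2
... | inj₁ refl = prime∤1 p-prime ℕ.∣-refl
odd-prime∤2 _ () _ | inj₂ refl

∣∧<⇒≡0 : ∀ {p d} → p ℕ.∣ d → d ℕ.< p → d ≡ 0
∣∧<⇒≡0 {d = ℕ.zero}  _   _   = refl
∣∧<⇒≡0 {d = ℕ.suc _} p∣d d<p = contradiction p∣d (ℕ.>⇒∤ d<p)

cong₃ : ∀ {A B C D : Set} (f : A → B → C → D) {a a′ b b′ c c′} →
        a ≡ a′ → b ≡ b′ → c ≡ c′ → f a b c ≡ f a′ b′ c′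
cong₃ f refl refl refl = refl

record ℤ³ : Set where
  constructor ⟨_,_,_⟩
  field π₁ π₂ π₃ : ℤ
open ℤ³ public

record ℤ³ˣ³ : Set where
  constructor rows
  field row₁ row₂ row₃ : ℤ³
open ℤ³ˣ³ public

infixl 6 _⊕_
infixl 7 _⊙_ _⊛_ _·_

0³ : ℤ³
0³ = ⟨ + 0 , + 0 , + 0 ⟩

_⊕_ : ℤ³ → ℤ³ → ℤ³
u ⊕ v = ⟨ π₁ u + π₁ v , π₂ u + π₂ v , π₃ u + π₃ v ⟩

_⊙_ : ℤ → ℤ³ → ℤ³
c ⊙ u = ⟨ c * π₁ u , c * π₂ u , c * π₃ u ⟩

_·_ : ℤ³ → ℤ³ → ℤ
u · v = π₁ u * π₁ v + π₂ u * π₂ v + π₃ u * π₃ v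

_⨯_ : ℤ³ → ℤ³ → ℤ³
u ⨯ v = ⟨ π₂ u * π₃ v - π₃ u * π₂ v , π₃ u * π₁ v - π₁ u * π₃ v , π₁ u * π₂ v - π₂ u * π₁ v ⟩

-- shaped like Defs.vecMat, trailing 0³ included, so that ιV-vecMat goes through componentwise
_⊛_ : ℤ³ → ℤ³ˣ³ → ℤ³
u ⊛ A = π₁ u ⊙ row₁ A ⊕ (π₂ u ⊙ row₂ A ⊕ (π₃ u ⊙ row₃ A ⊕ 0³))

_⊗_ : ℤ³ˣ³ → ℤ³ˣ³ → ℤ³ˣ³
A ⊗ B = rows (row₁ A ⊛ B) (row₂ A ⊛ B) (row₃ A ⊛ B)

X : ℤ → ℤ³ˣ³
X N = rows ⟨ + 1 , + 2 * N , + 2 * N * N ⟩ ⟨ + 0 , + 1 , + 2 * N ⟩ ⟨ + 0 , + 0 , + 1 ⟩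

act : ℤ → ℤ³ → ℤ³
act N s = ⟨ π₁ s , + 2 * N * π₁ s + π₂ s , + 2 * N * N * π₁ s + + 2 * N * π₂ s + π₃ s ⟩

⊛-X : ∀ s N → s ⊛ X N ≡ act N s
⊛-X ⟨ s₁ , s₂ , s₃ ⟩ N = cong₃ ⟨_,_,_⟩ (first s₁ s₂ s₃) (second s₁ s₂ s₃ N) (third s₁ s₂ s₃ N)
  where
  first : ∀ s₁ s₂ s₃ → s₁ * + 1 + (s₂ * + 0 + (s₃ * + 0 + + 0)) ≡ s₁
  first = solve-∀
  second : ∀ s₁ s₂ s₃ N → s₁ * (+ 2 * N) + (s₂ * + 1 + (s₃ * + 0 + + 0)) ≡ + 2 * N * s₁ + s₂
  second = solve-∀
  third : ∀ s₁ s₂ s₃ N → s₁ * (+ 2 * N * N) + (s₂ * (+ 2 * N) + (s₃ * + 1 + + 0))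
                         ≡ + 2 * N * N * s₁ + + 2 * N * s₂ + s₃
  third = solve-∀

act-inverse : ∀ N s → act (- N) (act N s) ≡ s
act-inverse N ⟨ s₁ , s₂ , s₃ ⟩ = cong₂ (λ a b → ⟨ s₁ , a , b ⟩) (second N s₁ s₂) (third N s₁ s₂ s₃)
  where
  second : ∀ N s₁ s₂ → + 2 * - N * s₁ + (+ 2 * N * s₁ + s₂) ≡ s₂
  second = solve-∀
  third : ∀ N s₁ s₂ s₃ → + 2 * - N * - N * s₁ + + 2 * - N * (+ 2 * N * s₁ + s₂)
                          + (+ 2 * N * N * s₁ + + 2 * N * s₂ + s₃) ≡ s₃
  third = solve-∀

X-step : ∀ N → X N ⊗ X (+ 1) ≡ X (+ 1 + N)
X-step N = cong₃ rows (trans (⊛-X (row₁ (X N)) (+ 1)) (cong₂ (λ a b → ⟨ + 1 , a , b ⟩) (linear N) (quadratic N)))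
                      (trans (⊛-X (row₂ (X N)) (+ 1)) (cong (λ a → ⟨ + 0 , + 1 , a ⟩) (linear N)))
                      (⊛-X (row₃ (X N)) (+ 1))
  where
  linear : ∀ N → + 2 + + 2 * N ≡ + 2 * (+ 1 + N)
  linear = solve-∀
  quadratic : ∀ N → + 2 + + 2 * (+ 2 * N) + + 2 * N * N ≡ + 2 * (+ 1 + N) * (+ 1 + N)
  quadratic = solve-∀

coeff₀ coeff₁ coeff₂ : ℤ³ → ℤ³ → ℤ
coeff₀ w n = w · n
coeff₁ w n = - (+ 2 * (π₁ w * π₂ n + π₂ w * π₃ n))
coeff₂ w n = + 2 * (π₁ w * π₃ n)

act-dot-expansion : ∀ N w n → act (- N) w · n ≡ coeff₀ w n + coeff₁ w n * N + coeff₂ w n * N * N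
act-dot-expansion N ⟨ w₁ , w₂ , w₃ ⟩ ⟨ n₁ , n₂ , n₃ ⟩ = identity N w₁ w₂ w₃ n₁ n₂ n₃
  where
  identity : ∀ N w₁ w₂ w₃ n₁ n₂ n₃ →
    w₁ * n₁ + (+ 2 * - N * w₁ + w₂) * n₂ + (+ 2 * - N * - N * w₁ + + 2 * - N * w₂ + w₃) * n₃
      ≡ w₁ * n₁ + w₂ * n₂ + w₃ * n₃ + - (+ 2 * (w₁ * n₂ + w₂ * n₃)) * N + + 2 * (w₁ * n₃) * N * N
  identity = solve-∀

span-normal : ∀ a b u v → (a ⊙ u ⊕ b ⊙ v) · (u ⨯ v) ≡ + 0
span-normal a b ⟨ u₁ , u₂ , u₃ ⟩ ⟨ v₁ , v₂ , v₃ ⟩ = identity a b u₁ u₂ u₃ v₁ v₂ v₃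
  where
  identity : ∀ a b u₁ u₂ u₃ v₁ v₂ v₃ →
    (a * u₁ + b * v₁) * (u₂ * v₃ - u₃ * v₂) + (a * u₂ + b * v₂) * (u₃ * v₁ - u₁ * v₃)
      + (a * u₃ + b * v₃) * (u₁ * v₂ - u₂ * v₁) ≡ + 0
  identity = solve-∀

span-first : ∀ u v → + 1 ⊙ u ⊕ + 0 ⊙ v ≡ u
span-first ⟨ u₁ , u₂ , u₃ ⟩ ⟨ v₁ , v₂ , v₃ ⟩ = cong₃ ⟨_,_,_⟩ (identity u₁ v₁) (identity u₂ v₂) (identity u₃ v₃)
  where
  identity : ∀ x y → + 1 * x + + 0 * y ≡ x
  identity = solve-∀

span-second : ∀ u v → + 0 ⊙ u ⊕ + 1 ⊙ v ≡ v
span-second ⟨ u₁ , u₂ , u₃ ⟩ ⟨ v₁ , v₂ , v₃ ⟩ = cong₃ ⟨_,_,_⟩ (identity u₁ v₁) (identity u₂ v₂) (identity u₃ v₃)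
  where
  identity : ∀ x y → + 0 * x + + 1 * y ≡ y
  identity = solve-∀

module Congruence (p : ℕ) where

  infix 4 _≋_

  record _≋_ (x y : ℤ) : Set where
    constructor ≋-intro
    field ∣-difference : + p ∣ x - y
  open _≋_ public

  ∣0 : + p ∣ + 0
  ∣0 = divides (+ 0) refl

  ∣-by : ∀ {x} y → x ≡ y → + p ∣ y → + p ∣ x
  ∣-by _ refl p∣y = p∣y

  ≋-by : ∀ {x y} d → x - y ≡ d → + p ∣ d → x ≋ y
  ≋-by d eq p∣d = ≋-intro (∣-by d eq p∣d)

  ≋-refl : ∀ {x} → x ≋ x
  ≋-refl {x} = ≋-by (+ 0) (ℤ.+-inverseʳ x) ∣0

  ≋-reflexive : ∀ {x y} → x ≡ y → x ≋ y
  ≋-reflexive refl = ≋-refl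

  ≋-sym : ∀ {x y} → x ≋ y → y ≋ x
  ≋-sym {x} {y} (≋-intro h) = ≋-by (- (x - y)) (identity x y) (∣m⇒∣-m h)
    where
    identity : ∀ x y → y - x ≡ - (x - y)
    identity = solve-∀

  ≋-trans : ∀ {x y z} → x ≋ y → y ≋ z → x ≋ z
  ≋-trans {x} {y} {z} (≋-intro h) (≋-intro k) =
    ≋-by ((x - y) + (y - z)) (identity x y z) (∣m∣n⇒∣m+n h k)
    where
    identity : ∀ x y z → x - z ≡ (x - y) + (y - z)
    identity = solve-∀

  +-cong : ∀ {x y x′ y′} → x ≋ x′ → y ≋ y′ → x + y ≋ x′ + y′
  +-cong {x} {y} {x′} {y′} (≋-intro h) (≋-intro k) =
    ≋-by ((x - x′) + (y - y′)) (identity x y x′ y′) (∣m∣n⇒∣m+n h k)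
    where
    identity : ∀ x y x′ y′ → x + y - (x′ + y′) ≡ (x - x′) + (y - y′)
    identity = solve-∀

  *-cong : ∀ {x y x′ y′} → x ≋ x′ → y ≋ y′ → x * y ≋ x′ * y′
  *-cong {x} {y} {x′} {y′} (≋-intro h) (≋-intro k) =
    ≋-by (y * (x - x′) + x′ * (y - y′)) (identity x y x′ y′)
      (∣m∣n⇒∣m+n (∣n⇒∣m*n y h) (∣n⇒∣m*n x′ k))
    where
    identity : ∀ x y x′ y′ → x * y - x′ * y′ ≡ y * (x - x′) + x′ * (y - y′)
    identity = solve-∀

  ∣⇒≋0 : ∀ {x} → + p ∣ x → x ≋ + 0
  ∣⇒≋0 {x} h = ≋-by x (ℤ.+-identityʳ x) h

  ≋0⇒∣ : ∀ {x} → x ≋ + 0 → + p ∣ x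
  ≋0⇒∣ {x} h = ∣-by (x - + 0) (sym (ℤ.+-identityʳ x)) (∣-difference h)

  cancel-inverse : ∀ x {y g} → y * g ≋ + 1 → x * g * y ≋ x
  cancel-inverse x {y} {g} (≋-intro yg≋1) = ≋-by _ (identity x y g) (∣n⇒∣m*n x yg≋1)
    where
    identity : ∀ x y g → x * g * y - x ≡ x * (y * g - + 1)
    identity = solve-∀

  ∣-neg : ∀ {x} → + p ∣ - x → + p ∣ x
  ∣-neg {x} h = subst (+ p ∣_) (ℤ.neg-involutive x) (∣m⇒∣-m h)

  ∣-resp-≋ : ∀ {x y} → x ≋ y → + p ∣ y → + p ∣ x
  ∣-resp-≋ x≋y p∣y = ≋0⇒∣ (≋-trans x≋y (∣⇒≋0 p∣y))

  ≋-%ℕ : .{{_ : NonZero p}} → ∀ z → + (z %ℕ p) ≋ z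
  ≋-%ℕ z = ≋-by (- (z /ℕ p) * + p)
    (trans (cong (λ w → + (z %ℕ p) - w) (a≡a%ℕn+[a/ℕn]*n z p)) (identity (+ (z %ℕ p)) (z /ℕ p) (+ p)))
    (∣n⇒∣m*n (- (z /ℕ p)) ∣-refl)
    where
    identity : ∀ r q d → r - (r + q * d) ≡ - q * d
    identity = solve-∀

  infix 4 _≋³_ _≋ᴹ_

  _≋³_ : ℤ³ → ℤ³ → Set
  u ≋³ v = π₁ u ≋ π₁ v × π₂ u ≋ π₂ v × π₃ u ≋ π₃ v

  _≋ᴹ_ : ℤ³ˣ³ → ℤ³ˣ³ → Set
  A ≋ᴹ B = row₁ A ≋³ row₁ B × row₂ A ≋³ row₂ B × row₃ A ≋³ row₃ B

  ≋³-refl : ∀ {u} → u ≋³ u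
  ≋³-refl = ≋-refl , ≋-refl , ≋-refl

  ≋³-reflexive : ∀ {u v} → u ≡ v → u ≋³ v
  ≋³-reflexive refl = ≋³-refl

  ≋³-sym : ∀ {u v} → u ≋³ v → v ≋³ u
  ≋³-sym (e₁ , e₂ , e₃) = ≋-sym e₁ , ≋-sym e₂ , ≋-sym e₃

  ≋³-trans : ∀ {u v w} → u ≋³ v → v ≋³ w → u ≋³ w
  ≋³-trans (e₁ , e₂ , e₃) (f₁ , f₂ , f₃) = ≋-trans e₁ f₁ , ≋-trans e₂ f₂ , ≋-trans e₃ f₃

  ≋ᴹ-reflexive : ∀ {A B} → A ≡ B → A ≋ᴹ B
  ≋ᴹ-reflexive refl = ≋³-refl , ≋³-refl , ≋³-refl

  ≋ᴹ-trans : ∀ {A B C} → A ≋ᴹ B → B ≋ᴹ C → A ≋ᴹ C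
  ≋ᴹ-trans (e₁ , e₂ , e₃) (f₁ , f₂ , f₃) = ≋³-trans e₁ f₁ , ≋³-trans e₂ f₂ , ≋³-trans e₃ f₃

  ⊕-cong : ∀ {u v u′ v′} → u ≋³ u′ → v ≋³ v′ → u ⊕ v ≋³ u′ ⊕ v′
  ⊕-cong (e₁ , e₂ , e₃) (f₁ , f₂ , f₃) = +-cong e₁ f₁ , +-cong e₂ f₂ , +-cong e₃ f₃

  ⊙-cong : ∀ {c c′ u u′} → c ≋ c′ → u ≋³ u′ → c ⊙ u ≋³ c′ ⊙ u′
  ⊙-cong c≋c′ (e₁ , e₂ , e₃) = *-cong c≋c′ e₁ , *-cong c≋c′ e₂ , *-cong c≋c′ e₃

  ·-cong : ∀ {u v u′ v′} → u ≋³ u′ → v ≋³ v′ → u · v ≋ u′ · v′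
  ·-cong (e₁ , e₂ , e₃) (f₁ , f₂ , f₃) = +-cong (+-cong (*-cong e₁ f₁) (*-cong e₂ f₂)) (*-cong e₃ f₃)

  ⊛-cong : ∀ {u u′ A A′} → u ≋³ u′ → A ≋ᴹ A′ → u ⊛ A ≋³ u′ ⊛ A′
  ⊛-cong (e₁ , e₂ , e₃) (f₁ , f₂ , f₃) =
    ⊕-cong (⊙-cong e₁ f₁) (⊕-cong (⊙-cong e₂ f₂) (⊕-cong (⊙-cong e₃ f₃) ≋³-refl))

  ⊗-cong : ∀ {A A′ B B′} → A ≋ᴹ A′ → B ≋ᴹ B′ → A ⊗ B ≋ᴹ A′ ⊗ B′
  ⊗-cong (e₁ , e₂ , e₃) B≋B′ = ⊛-cong e₁ B≋B′ , ⊛-cong e₂ B≋B′ , ⊛-cong e₃ B≋B′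

  act-cong : ∀ N {s s′} → s ≋³ s′ → act N s ≋³ act N s′
  act-cong N (e₁ , e₂ , e₃) =
    e₁ , +-cong (*-cong (≋-refl {+ 2 * N}) e₁) e₂
       , +-cong (+-cong (*-cong (≋-refl {+ 2 * N * N}) e₁) (*-cong (≋-refl {+ 2 * N}) e₂)) e₃

  act-fixes : ∀ N {w} → + p ∣ π₁ w → + p ∣ π₂ w → act N w ≋³ w
  act-fixes N {⟨ w₁ , w₂ , w₃ ⟩} p∣w₁ p∣w₂ =
    ≋-refl ,
    ≋-by (+ 2 * N * w₁) (identity₂ N w₁ w₂) (∣n⇒∣m*n (+ 2 * N) p∣w₁) ,
    ≋-by (+ 2 * N * N * w₁ + + 2 * N * w₂) (identity₃ N w₁ w₂ w₃)
      (∣m∣n⇒∣m+n (∣n⇒∣m*n (+ 2 * N * N) p∣w₁) (∣n⇒∣m*n (+ 2 * N) p∣w₂))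
    where
    identity₂ : ∀ N w₁ w₂ → + 2 * N * w₁ + w₂ - w₂ ≡ + 2 * N * w₁
    identity₂ = solve-∀
    identity₃ : ∀ N w₁ w₂ w₃ →
      + 2 * N * N * w₁ + + 2 * N * w₂ + w₃ - w₃ ≡ + 2 * N * N * w₁ + + 2 * N * w₂
    identity₃ = solve-∀

  ⊙-on-axis : ∀ c {v} → + p ∣ π₁ v → + p ∣ π₂ v → c ⊙ v ≋³ (c * π₃ v) ⊙ ⟨ + 0 , + 0 , + 1 ⟩
  ⊙-on-axis c {⟨ v₁ , v₂ , v₃ ⟩} p∣v₁ p∣v₂ =
    ≋-by _ (identity₀ c v₁ v₃) (∣n⇒∣m*n c p∣v₁) ,
    ≋-by _ (identity₀ c v₂ v₃) (∣n⇒∣m*n c p∣v₂) ,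
    ≋-by _ (identity₁ c v₃) ∣0
    where
    identity₀ : ∀ c vᵢ v₃ → c * vᵢ - c * v₃ * + 0 ≡ c * vᵢ
    identity₀ = solve-∀
    identity₁ : ∀ c v₃ → c * v₃ - c * v₃ * + 1 ≡ + 0
    identity₁ = solve-∀

  coordinate-plane : ∀ c d → c ⊙ ⟨ + 0 , + 1 , + 0 ⟩ ⊕ d ⊙ ⟨ + 0 , + 0 , + 1 ⟩ ≋³ ⟨ + 0 , c , d ⟩
  coordinate-plane c d =
    ≋-reflexive (identity₀ c d) , ≋-reflexive (identity₁ c d) , ≋-reflexive (identity₂ c d)
    where
    identity₀ : ∀ c d → c * + 0 + d * + 0 ≡ + 0
    identity₀ = solve-∀
    identity₁ : ∀ c d → c * + 1 + d * + 0 ≡ c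
    identity₁ = solve-∀
    identity₂ : ∀ c d → c * + 0 + d * + 1 ≡ d
    identity₂ = solve-∀

  act-shear : ∀ {s} → + p ∣ π₁ s → act (+ 1) s ≋³ ⟨ π₁ s , π₂ s , + 2 * π₂ s + π₃ s ⟩
  act-shear {⟨ s₁ , s₂ , s₃ ⟩} p∣s₁ =
    ≋-refl ,
    ≋-by _ (identity₂ s₁ s₂) (∣n⇒∣m*n (+ 2) p∣s₁) ,
    ≋-by _ (identity₃ s₁ s₂ s₃) (∣n⇒∣m*n (+ 2) p∣s₁)
    where
    identity₂ : ∀ s₁ s₂ → + 2 * s₁ + s₂ - s₂ ≡ + 2 * s₁
    identity₂ = solve-∀
    identity₃ : ∀ s₁ s₂ s₃ → + 2 * s₁ + + 2 * s₂ + s₃ - (+ 2 * s₂ + s₃) ≡ + 2 * s₁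
    identity₃ = solve-∀

  Independent : ℤ³ → ℤ³ → Set
  Independent u v = ∀ c d → c ⊙ u ⊕ d ⊙ v ≋³ 0³ → + p ∣ c × + p ∣ d

  module _ (p-prime : Prime p) where

    ∣-product : ∀ x y → + p ∣ x * y → + p ∣ x ⊎ + p ∣ y
    ∣-product x y h with euclidsLemma (abs x) (abs y) p-prime (subst (p ℕ.∣_) (ℤ.abs-* x y) (∣⇒∣ᵤ h))
    ... | inj₁ p∣x = inj₁ (∣ᵤ⇒∣ p∣x)
    ... | inj₂ p∣y = inj₂ (∣ᵤ⇒∣ p∣y)

    ∣-cancelˡ : ∀ {c x} → ¬ + p ∣ c → + p ∣ c * x → + p ∣ x
    ∣-cancelˡ {c} {x} p∤c h with ∣-product c x h
    ... | inj₁ p∣c = contradiction p∣c p∤c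
    ... | inj₂ p∣x = p∣x

    ∣-cancelʳ : ∀ {c x} → ¬ + p ∣ c → + p ∣ x * c → + p ∣ x
    ∣-cancelʳ {c} {x} p∤c h = ∣-cancelˡ p∤c (subst (+ p ∣_) (ℤ.*-comm x c) h)

    ∣-square : ∀ {x} → + p ∣ x * x → + p ∣ x
    ∣-square {x} h with ∣-product x x h
    ... | inj₁ p∣x = p∣x
    ... | inj₂ p∣x = p∣x

    ∤1 : ¬ + p ∣ + 1
    ∤1 h = prime∤1 p-prime (∣⇒∣ᵤ h)

    private instance
      p-nonZero : NonZero p
      p-nonZero = prime⇒nonZero p-prime

    residue-inverse : ∀ r .{{_ : NonZero r}} → r ℕ.< p → Σ ℤ λ y → + r * y ≋ + 1
    residue-inverse r r<p with coprime-Bézout (prime⇒coprime p-prime r<p)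
    ... | Bézout.+- a b eq = - + b , ≋-by (- + a * + p) r[-b]-1≡-ap (∣n⇒∣m*n (- + a) ∣-refl)
      where
      open ≡-Reasoning
      r[-b]-1≡-ap : + r * - + b - + 1 ≡ - + a * + p
      r[-b]-1≡-ap = begin
        + r * - + b - + 1    ≡⟨ identity (+ r) (+ b) ⟩
        - (+ 1 + + b * + r)  ≡⟨ cong (λ t → - (+ 1 + t)) (sym (ℤ.pos-* b r)) ⟩
        - + (1 ℕ.+ b ℕ.* r)  ≡⟨ cong (λ t → - + t) eq ⟩
        - + (a ℕ.* p)        ≡⟨ cong -_ (ℤ.pos-* a p) ⟩
        - (+ a * + p)        ≡⟨ ℤ.neg-distribˡ-* (+ a) (+ p) ⟩
        - + a * + p          ∎
        where
        identity : ∀ r b → r * - b - + 1 ≡ - (+ 1 + b * r)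
        identity = solve-∀
    ... | Bézout.-+ a b eq = + b , ≋-by (+ a * + p) rb-1≡ap (∣n⇒∣m*n (+ a) ∣-refl)
      where
      open ≡-Reasoning
      rb-1≡ap : + r * + b - + 1 ≡ + a * + p
      rb-1≡ap = begin
        + r * + b - + 1          ≡⟨ identity (+ r) (+ b) ⟩
        + b * + r - + 1          ≡⟨ cong (_- + 1) (sym (ℤ.pos-* b r)) ⟩
        + (b ℕ.* r) - + 1        ≡⟨ cong (λ t → + t - + 1) (sym eq) ⟩
        + (1 ℕ.+ a ℕ.* p) - + 1  ≡⟨ cong (λ t → + 1 + t - + 1) (ℤ.pos-* a p) ⟩
        + 1 + + a * + p - + 1    ≡⟨ cancel (+ a * + p) ⟩
        + a * + p                ∎
        where
        identity : ∀ r b → r * b - + 1 ≡ b * r - + 1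
        identity = solve-∀
        cancel : ∀ t → + 1 + t - + 1 ≡ t
        cancel = solve-∀

    inverse : ∀ {x} → ¬ + p ∣ x → Σ ℤ λ y → x * y ≋ + 1
    inverse {x} p∤x with x %ℕ p | ≋-%ℕ x | n%ℕd<d x p
    ... | ℕ.zero      | 0≋x | _   = contradiction (∣-resp-≋ (≋-sym 0≋x) ∣0) p∤x
    ... | r@(ℕ.suc _) | r≋x | r<p with residue-inverse r r<p
    ...   | y , ry≋1 = y , ≋-trans (*-cong (≋-sym r≋x) ≋-refl) ry≋1

    ∣? : ∀ x → Dec (+ p ∣ x)
    ∣? x = map′ ∣ᵤ⇒∣ ∣⇒∣ᵤ (p ℕ.∣? abs x)

    module _ (p-odd : p % 2 ≡ 1) where

      ∣-half : ∀ {x} → + p ∣ + 2 * x → + p ∣ x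
      ∣-half = ∣-cancelˡ {+ 2} (λ p∣2 → odd-prime∤2 p-prime p-odd (∣⇒∣ᵤ p∣2))

module Residues (p : ℕ) .{{_ : NonZero p}} where
  open Congruence p

  ι : F p → ℤ
  ι a = + toℕ a

  ι-mod : ∀ n → ι (n ℕ.mod p) ≋ + n
  ι-mod n = subst (_≋ + n) (cong +_ (sym (toℕ-fromℕ< (ℕ.m%n<n n p)))) (≋-%ℕ (+ n))

  ι-+F : ∀ a b → ι (_+F_ p a b) ≋ ι a + ι b
  ι-+F a b = ι-mod (toℕ a ℕ.+ toℕ b)

  ι-*F : ∀ a b → ι (_*F_ p a b) ≋ ι a * ι b
  ι-*F a b = ≋-trans (ι-mod (toℕ a ℕ.* toℕ b)) (≋-reflexive (ℤ.pos-* (toℕ a) (toℕ b)))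

  ι-0F : ι (0F p) ≋ + 0
  ι-0F = ι-mod 0

  ι-1F : ι (1F p) ≋ + 1
  ι-1F = ι-mod 1

  ι-2F : ι (2F p) ≋ + 2
  ι-2F = ι-mod 2

  ι-injective : ∀ {a b} → ι a ≋ ι b → a ≡ b
  ι-injective {a} {b} (≋-intro h) = toℕ-injective (ℕ.∣m-n∣≡0⇒m≡n (∣∧<⇒≡0 p∣distance distance<p))
    where
    m n : ℕ
    m = toℕ a
    n = toℕ b
    p∣distance : p ℕ.∣ ℕ.∣ m - n ∣
    p∣distance = subst (p ℕ.∣_) (abs-difference m n) (∣⇒∣ᵤ h)
      where
      abs-difference : ∀ m n → abs (+ m - + n) ≡ ℕ.∣ m - n ∣
      abs-difference m n with ℕ.≤-total m n
      ... | inj₁ m≤n = trans (cong abs (ℤ.m-n≡m⊖n m n))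
                             (trans (ℤ.∣⊖∣-≤ m≤n) (sym (ℕ.m≤n⇒∣m-n∣≡n∸m m≤n)))
      ... | inj₂ n≤m = trans (cong abs (ℤ.m-n≡m⊖n m n))
                             (trans (ℤ.∣m⊖n∣≡∣n⊖m∣ m n)
                             (trans (ℤ.∣⊖∣-≤ n≤m) (sym (ℕ.m≤n⇒∣n-m∣≡n∸m n≤m))))
    distance<p : ℕ.∣ m - n ∣ ℕ.< p
    distance<p = ℕ.≤-<-trans (ℕ.∣m-n∣≤m⊔n m n) (ℕ.⊔-lub (toℕ<n a) (toℕ<n b))

  reduce : ℤ → F p
  reduce z = fromℕ< (n%ℕd<d z p)

  ι-reduce : ∀ z → ι (reduce z) ≋ z
  ι-reduce z = subst (_≋ z) (cong +_ (sym (toℕ-fromℕ< (n%ℕd<d z p)))) (≋-%ℕ z)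

  ιV : V p → ℤ³
  ιV (a ∷ b ∷ c ∷ []) = ⟨ ι a , ι b , ι c ⟩

  ιM : Mat p → ℤ³ˣ³
  ιM (r₁ ∷ r₂ ∷ r₃ ∷ []) = rows (ιV r₁) (ιV r₂) (ιV r₃)

  ιV-injective : ∀ {u v} → ιV u ≋³ ιV v → u ≡ v
  ιV-injective {_ ∷ _ ∷ _ ∷ []} {_ ∷ _ ∷ _ ∷ []} (e₁ , e₂ , e₃)
    rewrite ι-injective e₁ | ι-injective e₂ | ι-injective e₃ = refl

  ιV-0V : ιV (0V p) ≋³ 0³
  ιV-0V = ι-0F , ι-0F , ι-0F

  ιV≋0 : ∀ {w} → ιV w ≋³ 0³ → w ≡ 0V p
  ιV≋0 w≋0 = ιV-injective (≋³-trans w≋0 (≋³-sym ιV-0V))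

  ιV-cong : ∀ {u v} → u ≡ v → ιV u ≋³ ιV v
  ιV-cong e = ≋³-reflexive (cong ιV e)

  ιV-+V : ∀ u v → ιV (_+V_ p u v) ≋³ ιV u ⊕ ιV v
  ιV-+V (a ∷ b ∷ c ∷ []) (a′ ∷ b′ ∷ c′ ∷ []) = ι-+F a a′ , ι-+F b b′ , ι-+F c c′

  ιV-·V : ∀ c u → ιV (_·V_ p c u) ≋³ ι c ⊙ ιV u
  ιV-·V c (a ∷ b ∷ d ∷ []) = ι-*F c a , ι-*F c b , ι-*F c d

  ιV-vecMat : ∀ u M → ιV (vecMat p u M) ≋³ ιV u ⊛ ιM M
  ιV-vecMat (a ∷ b ∷ c ∷ []) (r₁ ∷ r₂ ∷ r₃ ∷ []) =
    ≋³-trans (ιV-+V (_·V_ p a r₁) (vecMat p (b ∷ c ∷ []) (r₂ ∷ r₃ ∷ []))) (⊕-cong (ιV-·V a r₁)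
    (≋³-trans (ιV-+V (_·V_ p b r₂) (vecMat p (c ∷ []) (r₃ ∷ []))) (⊕-cong (ιV-·V b r₂)
    (≋³-trans (ιV-+V (_·V_ p c r₃) (0V p)) (⊕-cong (ιV-·V c r₃) ιV-0V)))))

  ιM-matMul : ∀ A B → ιM (matMul p A B) ≋ᴹ ιM A ⊗ ιM B
  ιM-matMul (r₁ ∷ r₂ ∷ r₃ ∷ []) B = ιV-vecMat r₁ B , ιV-vecMat r₂ B , ιV-vecMat r₃ B

  ιM-I3 : ιM (I3 p) ≋ᴹ X (+ 0)
  ιM-I3 = (ι-1F , ι-0F , ι-0F) , (ι-0F , ι-1F , ι-0F) , (ι-0F , ι-0F , ι-1F)

  ιM-xMat : ιM (xMat p) ≋ᴹ X (+ 1)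
  ιM-xMat = (ι-1F , ι-2F , ι-2F) , (ι-0F , ι-1F , ι-2F) , (ι-0F , ι-0F , ι-1F)

  ιM-mpow : ∀ n → ιM (mpow p (xMat p) n) ≋ᴹ X (+ n)
  ιM-mpow ℕ.zero    = ιM-I3
  ιM-mpow (ℕ.suc n) = ≋ᴹ-trans (ιM-matMul (mpow p (xMat p) n) (xMat p))
                     (≋ᴹ-trans (⊗-cong (ιM-mpow n) ιM-xMat) (≋ᴹ-reflexive (X-step (+ n))))

  ιV-span2 : ∀ a b u v → ιV (_+V_ p (_·V_ p a u) (_·V_ p b v)) ≋³ ι a ⊙ ιV u ⊕ ι b ⊙ ιV v
  ιV-span2 a b u v = ≋³-trans (ιV-+V (_·V_ p a u) (_·V_ p b v)) (⊕-cong (ιV-·V a u) (ιV-·V b v))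

  ιV-span2-reduce : ∀ c d u v →
    ιV (_+V_ p (_·V_ p (reduce c) u) (_·V_ p (reduce d) v)) ≋³ c ⊙ ιV u ⊕ d ⊙ ιV v
  ιV-span2-reduce c d u v = ≋³-trans (ιV-span2 (reduce c) (reduce d) u v)
    (⊕-cong (⊙-cong (ι-reduce c) (≋³-refl {ιV u})) (⊙-cong (ι-reduce d) (≋³-refl {ιV v})))

  ιV-α : ιV (α p) ≋³ ⟨ + 0 , + 0 , + 1 ⟩
  ιV-α = ι-0F , ι-0F , ι-1F

  ιV-S' : ∀ a₂ a₃ → ιV (0F p ∷ a₂ ∷ a₃ ∷ []) ≋³ ⟨ + 0 , ι a₂ , ι a₃ ⟩
  ιV-S' a₂ a₃ = ι-0F , ≋-refl , ≋-refl

  ι-*0F : ∀ c → ι (_*F_ p c (0F p)) ≋ + 0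
  ι-*0F c = ≋-trans (ι-*F c (0F p)) (≋-trans (*-cong (≋-refl {ι c}) ι-0F) (≋-reflexive (ℤ.*-zeroʳ (ι c))))

  ιV-1·V : ∀ v → ιV (_·V_ p (1F p) v) ≋³ ιV v
  ιV-1·V v = ≋³-trans (ιV-·V (1F p) v)
    (≋³-trans (⊙-cong ι-1F (≋³-refl {ιV v})) (≋³-reflexive (one-⊙ (ιV v))))
    where
    one-⊙ : ∀ w → + 1 ⊙ w ≡ w
    one-⊙ ⟨ w₁ , w₂ , w₃ ⟩ = cong₃ ⟨_,_,_⟩ (ℤ.*-identityˡ w₁) (ℤ.*-identityˡ w₂) (ℤ.*-identityˡ w₃)

  action : ∀ M N → ιM M ≋ᴹ X N → ∀ s → ιV (vecMat p s M) ≋³ act N (ιV s)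
  action M N M≋X s =
    ≋³-trans (ιV-vecMat s M) (≋³-trans (⊛-cong (≋³-refl {ιV s}) M≋X) (≋³-reflexive (⊛-X (ιV s) N)))

  x-action : ∀ s → ιV (vecMat p s (xMat p)) ≋³ act (+ 1) (ιV s)
  x-action = action (xMat p) (+ 1) ιM-xMat

module OddPrime (p : ℕ) (p-prime : Prime p) (p-odd : p % 2 ≡ 1) where
  open Congruence p

  quadratic-root-difference : ∀ {A B C s t} → ¬ + p ∣ s - t →
    + p ∣ A + B * s + C * s * s → + p ∣ A + B * t + C * t * t → + p ∣ B + C * (s + t)
  quadratic-root-difference {A} {B} {C} {s} {t} p∤s-t rₛ rₜ =
    ∣-cancelʳ p-prime p∤s-t (∣-by _ (identity A B C s t) (∣m∣n⇒∣m-n rₛ rₜ))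
    where
    identity : ∀ A B C s t →
      (B + C * (s + t)) * (s - t) ≡ (A + B * s + C * s * s) - (A + B * t + C * t * t)
    identity = solve-∀

  three-roots : ∀ {A B C i j k} → ¬ + p ∣ i - j → ¬ + p ∣ i - k → ¬ + p ∣ j - k →
    + p ∣ A + B * i + C * i * i → + p ∣ A + B * j + C * j * j → + p ∣ A + B * k + C * k * k →
    + p ∣ A × + p ∣ B × + p ∣ C
  three-roots {A} {B} {C} {i} {j} {k} p∤i-j p∤i-k p∤j-k rᵢ rⱼ rₖ = p∣A , p∣B , p∣C
    where
    dᵢⱼ : + p ∣ B + C * (i + j)
    dᵢⱼ = quadratic-root-difference {A} {B} {C} {i} {j} p∤i-j rᵢ rⱼ
    dᵢₖ : + p ∣ B + C * (i + k)
    dᵢₖ = quadratic-root-difference {A} {B} {C} {i} {k} p∤i-k rᵢ rₖ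
    p∣C : + p ∣ C
    p∣C = ∣-cancelʳ p-prime p∤j-k (∣-by _ (identity B C i j k) (∣m∣n⇒∣m-n dᵢⱼ dᵢₖ))
      where
      identity : ∀ B C i j k → C * (j - k) ≡ (B + C * (i + j)) - (B + C * (i + k))
      identity = solve-∀
    p∣B : + p ∣ B
    p∣B = ∣-by _ (identity B C i j) (∣m∣n⇒∣m-n dᵢⱼ (∣n⇒∣m*n (i + j) p∣C))
      where
      identity : ∀ B C i j → B ≡ (B + C * (i + j)) - (i + j) * C
      identity = solve-∀
    p∣A : + p ∣ A
    p∣A = ∣-by _ (identity A B C i) (∣m∣n⇒∣m-n (∣m∣n⇒∣m-n rᵢ (∣n⇒∣m*n i p∣B)) (∣n⇒∣m*n (i * i) p∣C))
      where
      identity : ∀ A B C i → A ≡ (A + B * i + C * i * i) - i * B - i * i * C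
      identity = solve-∀

  triangular-zero : ∀ {w₁ w₂ w₃ n₁ n₂ n₃} → ¬ + p ∣ n₃ →
    + p ∣ w₁ * n₃ → + p ∣ w₁ * n₂ + w₂ * n₃ → + p ∣ w₁ * n₁ + w₂ * n₂ + w₃ * n₃ →
    + p ∣ w₁ × + p ∣ w₂ × + p ∣ w₃
  triangular-zero {w₁} {w₂} {w₃} {n₁} {n₂} {n₃} p∤n₃ e₂ e₁ e₀ = p∣w₁ , p∣w₂ , p∣w₃
    where
    p∣w₁ : + p ∣ w₁
    p∣w₁ = ∣-cancelʳ p-prime p∤n₃ e₂
    p∣w₂ : + p ∣ w₂
    p∣w₂ = ∣-cancelʳ p-prime p∤n₃
      (∣-by _ (identity₂ w₁ w₂ n₂ n₃) (∣m∣n⇒∣m-n e₁ (∣n⇒∣m*n n₂ p∣w₁)))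
      where
      identity₂ : ∀ w₁ w₂ n₂ n₃ → w₂ * n₃ ≡ (w₁ * n₂ + w₂ * n₃) - n₂ * w₁
      identity₂ = solve-∀
    p∣w₃ : + p ∣ w₃
    p∣w₃ = ∣-cancelʳ p-prime p∤n₃
      (∣-by _ (identity₃ w₁ w₂ w₃ n₁ n₂ n₃)
        (∣m∣n⇒∣m-n (∣m∣n⇒∣m-n e₀ (∣n⇒∣m*n n₁ p∣w₁)) (∣n⇒∣m*n n₂ p∣w₂)))
      where
      identity₃ : ∀ w₁ w₂ w₃ n₁ n₂ n₃ →
        w₃ * n₃ ≡ (w₁ * n₁ + w₂ * n₂ + w₃ * n₃) - n₁ * w₁ - n₂ * w₂
      identity₃ = solve-∀

  fixed-plane-normal : ∀ u v → let n = u ⨯ v in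
    + p ∣ coeff₁ u n + coeff₂ u n → + p ∣ coeff₁ v n + coeff₂ v n → + p ∣ π₂ n × + p ∣ π₃ n
  fixed-plane-normal ⟨ u₁ , u₂ , u₃ ⟩ ⟨ v₁ , v₂ , v₃ ⟩ hᵤ hᵥ = p∣n₂ , p∣n₃
    where
    p∣n₃ : + p ∣ u₁ * v₂ - u₂ * v₁
    p∣n₃ = ∣-square p-prime (∣-half p-prime p-odd
      (∣-by _ (identity₃ u₁ u₂ u₃ v₁ v₂ v₃) (∣m∣n⇒∣m-n (∣n⇒∣m*n v₁ hᵤ) (∣n⇒∣m*n u₁ hᵥ))))
      where
      identity₃ : ∀ u₁ u₂ u₃ v₁ v₂ v₃ →
        let n₂ = u₃ * v₁ - u₁ * v₃; n₃ = u₁ * v₂ - u₂ * v₁ in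
        + 2 * (n₃ * n₃) ≡ v₁ * (- (+ 2 * (u₁ * n₂ + u₂ * n₃)) + + 2 * (u₁ * n₃))
                        - u₁ * (- (+ 2 * (v₁ * n₂ + v₂ * n₃)) + + 2 * (v₁ * n₃))
      identity₃ = solve-∀
    p∣n₂ : + p ∣ u₃ * v₁ - u₁ * v₃
    p∣n₂ = ∣-square p-prime (∣-half p-prime p-odd
      (∣-by _ (identity₂ u₁ u₂ u₃ v₁ v₂ v₃)
        (∣m∣n⇒∣m-n (∣m∣n⇒∣m-n (∣n⇒∣m*n v₃ hᵤ) (∣n⇒∣m*n u₃ hᵥ)) (∣m⇒∣m*n _ p∣n₃))))
      where
      identity₂ : ∀ u₁ u₂ u₃ v₁ v₂ v₃ →
        let n₂ = u₃ * v₁ - u₁ * v₃; n₃ = u₁ * v₂ - u₂ * v₁ in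
        + 2 * (n₂ * n₂) ≡ v₃ * (- (+ 2 * (u₁ * n₂ + u₂ * n₃)) + + 2 * (u₁ * n₃))
                        - u₃ * (- (+ 2 * (v₁ * n₂ + v₂ * n₃)) + + 2 * (v₁ * n₃))
                        - n₃ * (+ 2 * u₃ * v₂ - + 2 * u₃ * v₁ - + 2 * v₃ * u₂ + + 2 * v₃ * u₁)
      identity₂ = solve-∀

  eigenvector-on-axis : ∀ {c v} → act (+ 1) v ≋³ c ⊙ v → + p ∣ π₁ v × + p ∣ π₂ v
  eigenvector-on-axis {c} {⟨ v₁ , v₂ , v₃ ⟩} (≋-intro h₁ , ≋-intro h₂ , ≋-intro h₃) = p∣v₁ , p∣v₂
    where
    p∣v₁ : + p ∣ v₁
    p∣v₁ = ∣-square p-prime (∣-half p-prime p-odd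
      (∣-by _ (identity₁ c v₁ v₂) (∣m∣n⇒∣m-n (∣n⇒∣m*n v₁ h₂) (∣n⇒∣m*n v₂ h₁))))
      where
      identity₁ : ∀ c v₁ v₂ → + 2 * (v₁ * v₁) ≡ v₁ * (+ 2 * v₁ + v₂ - c * v₂) - v₂ * (v₁ - c * v₁)
      identity₁ = solve-∀
    p∣v₂ : + p ∣ v₂
    p∣v₂ = ∣-square p-prime (∣-half p-prime p-odd
      (∣-by _ (identity₂ c v₁ v₂ v₃)
        (∣m∣n⇒∣m+n (∣m∣n⇒∣m-n (∣n⇒∣m*n v₂ h₃) (∣n⇒∣m*n v₃ h₂)) (∣n⇒∣m*n (+ 2 * v₃ - + 2 * v₂) p∣v₁))))
      where
      identity₂ : ∀ c v₁ v₂ v₃ →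
        + 2 * (v₂ * v₂) ≡ v₂ * (+ 2 * v₁ + + 2 * v₂ + v₃ - c * v₃) - v₃ * (+ 2 * v₁ + v₂ - c * v₂)
                          + (+ 2 * v₃ - + 2 * v₂) * v₁
      identity₂ = solve-∀

  -- (a · v) u − (a · u) v = a × (u × v)
  normal≋0⇒dependent : ∀ {u v} → u ⨯ v ≋³ 0³ → ∀ a → (a · v) ⊙ u ⊕ (- (a · u)) ⊙ v ≋³ 0³
  normal≋0⇒dependent {⟨ u₁ , u₂ , u₃ ⟩} {⟨ v₁ , v₂ , v₃ ⟩} (n₁≋0 , n₂≋0 , n₃≋0) ⟨ a₁ , a₂ , a₃ ⟩ =
    ≋-by _ (identity₁ a₁ a₂ a₃ u₁ u₂ u₃ v₁ v₂ v₃) (∣m∣n⇒∣m-n (∣n⇒∣m*n a₂ p∣n₃) (∣n⇒∣m*n a₃ p∣n₂)) ,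
    ≋-by _ (identity₂ a₁ a₂ a₃ u₁ u₂ u₃ v₁ v₂ v₃) (∣m∣n⇒∣m-n (∣n⇒∣m*n a₃ p∣n₁) (∣n⇒∣m*n a₁ p∣n₃)) ,
    ≋-by _ (identity₃ a₁ a₂ a₃ u₁ u₂ u₃ v₁ v₂ v₃) (∣m∣n⇒∣m-n (∣n⇒∣m*n a₁ p∣n₂) (∣n⇒∣m*n a₂ p∣n₁))
    where
    p∣n₁ : + p ∣ u₂ * v₃ - u₃ * v₂
    p∣n₁ = ≋0⇒∣ n₁≋0
    p∣n₂ : + p ∣ u₃ * v₁ - u₁ * v₃
    p∣n₂ = ≋0⇒∣ n₂≋0
    p∣n₃ : + p ∣ u₁ * v₂ - u₂ * v₁
    p∣n₃ = ≋0⇒∣ n₃≋0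
    identity₁ : ∀ a₁ a₂ a₃ u₁ u₂ u₃ v₁ v₂ v₃ →
      let n₂ = u₃ * v₁ - u₁ * v₃; n₃ = u₁ * v₂ - u₂ * v₁ in
      (a₁ * v₁ + a₂ * v₂ + a₃ * v₃) * u₁ + - (a₁ * u₁ + a₂ * u₂ + a₃ * u₃) * v₁ - + 0 ≡ a₂ * n₃ - a₃ * n₂
    identity₁ = solve-∀
    identity₂ : ∀ a₁ a₂ a₃ u₁ u₂ u₃ v₁ v₂ v₃ →
      let n₁ = u₂ * v₃ - u₃ * v₂; n₃ = u₁ * v₂ - u₂ * v₁ in
      (a₁ * v₁ + a₂ * v₂ + a₃ * v₃) * u₂ + - (a₁ * u₁ + a₂ * u₂ + a₃ * u₃) * v₂ - + 0 ≡ a₃ * n₁ - a₁ * n₃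
    identity₂ = solve-∀
    identity₃ : ∀ a₁ a₂ a₃ u₁ u₂ u₃ v₁ v₂ v₃ →
      let n₁ = u₂ * v₃ - u₃ * v₂; n₂ = u₃ * v₁ - u₁ * v₃ in
      (a₁ * v₁ + a₂ * v₂ + a₃ * v₃) * u₃ + - (a₁ * u₁ + a₂ * u₂ + a₃ * u₃) * v₃ - + 0 ≡ a₁ * n₂ - a₂ * n₁
    identity₃ = solve-∀

  independent⇒normal≉0 : ∀ {u v} → Independent u v → ¬ (u ⨯ v ≋³ 0³)
  independent⇒normal≉0 {u@(⟨ u₁ , u₂ , u₃ ⟩)} {v@(⟨ v₁ , v₂ , v₃ ⟩)} indep n≋0 =
    ∤1 p-prime (proj₁ (indep (+ 1) (+ 0) u≋0))
    where
    coordinate : ∀ a {x} → a · u ≡ x → + p ∣ x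
    coordinate a a·u≡x = subst (+ p ∣_) (trans (ℤ.neg-involutive (a · u)) a·u≡x)
      (∣m⇒∣-m (proj₂ (indep (a · v) (- (a · u)) (normal≋0⇒dependent {u} {v} n≋0 a))))
    first : ∀ x y z → + 1 * x + + 0 * y + + 0 * z ≡ x
    first = solve-∀
    second : ∀ x y z → + 0 * x + + 1 * y + + 0 * z ≡ y
    second = solve-∀
    third : ∀ x y z → + 0 * x + + 0 * y + + 1 * z ≡ z
    third = solve-∀
    component : ∀ x y → + 1 * x + + 0 * y - + 0 ≡ x
    component = solve-∀
    u≋0 : + 1 ⊙ u ⊕ + 0 ⊙ v ≋³ 0³
    u≋0 = ≋-by _ (component u₁ v₁) (coordinate ⟨ + 1 , + 0 , + 0 ⟩ (first u₁ u₂ u₃)) ,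
          ≋-by _ (component u₂ v₂) (coordinate ⟨ + 0 , + 1 , + 0 ⟩ (second u₁ u₂ u₃)) ,
          ≋-by _ (component u₃ v₃) (coordinate ⟨ + 0 , + 0 , + 1 ⟩ (third u₁ u₂ u₃))

  e₃∈span-via-n₂ : ∀ {u v g} → + p ∣ π₃ (u ⨯ v) → π₂ (u ⨯ v) * g ≋ + 1 →
    ⟨ + 0 , + 0 , + 1 ⟩ ≋³ (g * π₁ v) ⊙ u ⊕ (- (g * π₁ u)) ⊙ v
  e₃∈span-via-n₂ {⟨ u₁ , u₂ , u₃ ⟩} {⟨ v₁ , v₂ , v₃ ⟩} {g} p∣n₃ (≋-intro n₂g≋1) =
    ≋-by _ (identity₁ g u₁ v₁) ∣0 ,
    ≋-by _ (identity₂ g u₁ u₂ v₁ v₂) (∣n⇒∣m*n g p∣n₃) ,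
    ≋-by _ (identity₃ g u₁ u₃ v₁ v₃) (∣m⇒∣-m n₂g≋1)
    where
    identity₁ : ∀ g u₁ v₁ → + 0 - (g * v₁ * u₁ + - (g * u₁) * v₁) ≡ + 0
    identity₁ = solve-∀
    identity₂ : ∀ g u₁ u₂ v₁ v₂ → + 0 - (g * v₁ * u₂ + - (g * u₁) * v₂) ≡ g * (u₁ * v₂ - u₂ * v₁)
    identity₂ = solve-∀
    identity₃ : ∀ g u₁ u₃ v₁ v₃ →
      + 1 - (g * v₁ * u₃ + - (g * u₁) * v₃) ≡ - ((u₃ * v₁ - u₁ * v₃) * g - + 1)
    identity₃ = solve-∀

  e₃∈span-via-n₁ : ∀ {u v g} → + p ∣ π₃ (u ⨯ v) → π₁ (u ⨯ v) * g ≋ + 1 →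
    ⟨ + 0 , + 0 , + 1 ⟩ ≋³ (- (g * π₂ v)) ⊙ u ⊕ (g * π₂ u) ⊙ v
  e₃∈span-via-n₁ {⟨ u₁ , u₂ , u₃ ⟩} {⟨ v₁ , v₂ , v₃ ⟩} {g} p∣n₃ (≋-intro n₁g≋1) =
    ≋-by _ (identity₁ g u₁ u₂ v₁ v₂) (∣n⇒∣m*n g p∣n₃) ,
    ≋-by _ (identity₂ g u₂ v₂) ∣0 ,
    ≋-by _ (identity₃ g u₂ u₃ v₂ v₃) (∣m⇒∣-m n₁g≋1)
    where
    identity₁ : ∀ g u₁ u₂ v₁ v₂ → + 0 - (- (g * v₂) * u₁ + g * u₂ * v₁) ≡ g * (u₁ * v₂ - u₂ * v₁)
    identity₁ = solve-∀
    identity₂ : ∀ g u₂ v₂ → + 0 - (- (g * v₂) * u₂ + g * u₂ * v₂) ≡ + 0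
    identity₂ = solve-∀
    identity₃ : ∀ g u₂ u₃ v₂ v₃ →
      + 1 - (- (g * v₂) * u₃ + g * u₂ * v₃) ≡ - ((u₂ * v₃ - u₃ * v₂) * g - + 1)
    identity₃ = solve-∀

  p∣n₃⇒e₃∈span : ∀ {u v} → Independent u v → + p ∣ π₃ (u ⨯ v) →
    Σ ℤ λ c → Σ ℤ λ d → ⟨ + 0 , + 0 , + 1 ⟩ ≋³ c ⊙ u ⊕ d ⊙ v
  p∣n₃⇒e₃∈span {u} {v} indep p∣n₃ with ∣? p-prime (π₂ (u ⨯ v))
  ... | no p∤n₂ = let g , n₂g≋1 = inverse p-prime p∤n₂ in
    g * π₁ v , - (g * π₁ u) , e₃∈span-via-n₂ {u} {v} p∣n₃ n₂g≋1
  ... | yes p∣n₂ with ∣? p-prime (π₁ (u ⨯ v))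
  ...   | no p∤n₁ = let g , n₁g≋1 = inverse p-prime p∤n₁ in
    - (g * π₂ v) , g * π₂ u , e₃∈span-via-n₁ {u} {v} p∣n₃ n₁g≋1
  ...   | yes p∣n₁ =
    contradiction (∣⇒≋0 p∣n₁ , ∣⇒≋0 p∣n₂ , ∣⇒≋0 p∣n₃) (independent⇒normal≉0 {u} {v} indep)

  first-coordinate-zero : ∀ {w n} → ¬ + p ∣ π₁ n → + p ∣ π₂ n → + p ∣ π₃ n → + p ∣ w · n → + p ∣ π₁ w
  first-coordinate-zero {⟨ w₁ , w₂ , w₃ ⟩} {⟨ n₁ , n₂ , n₃ ⟩} p∤n₁ p∣n₂ p∣n₃ p∣w·n =
    ∣-cancelʳ p-prime p∤n₁ (∣-by _ (identity w₁ w₂ w₃ n₁ n₂ n₃)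
      (∣m∣n⇒∣m-n (∣m∣n⇒∣m-n p∣w·n (∣n⇒∣m*n w₂ p∣n₂)) (∣n⇒∣m*n w₃ p∣n₃)))
    where
    identity : ∀ w₁ w₂ w₃ n₁ n₂ n₃ → w₁ * n₁ ≡ (w₁ * n₁ + w₂ * n₂ + w₃ * n₃) - w₂ * n₂ - w₃ * n₃
    identity = solve-∀

  -- Cramer's rule for a plane whose normal is a multiple of e₁
  cramer : ∀ {u v g} → + p ∣ π₁ u → + p ∣ π₁ v → π₁ (u ⨯ v) * g ≋ + 1 → ∀ a₂ a₃ →
    ⟨ + 0 , a₂ , a₃ ⟩ ≋³ (g * (a₂ * π₃ v - a₃ * π₂ v)) ⊙ u ⊕ (g * (π₂ u * a₃ - π₃ u * a₂)) ⊙ v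
  cramer {⟨ u₁ , u₂ , u₃ ⟩} {⟨ v₁ , v₂ , v₃ ⟩} {g} p∣u₁ p∣v₁ (≋-intro n₁g≋1) a₂ a₃ =
    ≋-by _ (identity₁ g a₂ a₃ u₁ u₂ u₃ v₁ v₂ v₃)
      (∣m⇒∣-m (∣m∣n⇒∣m+n (∣n⇒∣m*n (g * (a₂ * v₃ - a₃ * v₂)) p∣u₁) (∣n⇒∣m*n (g * (u₂ * a₃ - u₃ * a₂)) p∣v₁))) ,
    ≋-by _ (identity₂ g a₂ a₃ u₂ u₃ v₂ v₃) (∣n⇒∣m*n (- a₂) n₁g≋1) ,
    ≋-by _ (identity₃ g a₂ a₃ u₂ u₃ v₂ v₃) (∣n⇒∣m*n (- a₃) n₁g≋1)
    where
    identity₁ : ∀ g a₂ a₃ u₁ u₂ u₃ v₁ v₂ v₃ →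
      + 0 - (g * (a₂ * v₃ - a₃ * v₂) * u₁ + g * (u₂ * a₃ - u₃ * a₂) * v₁)
        ≡ - (g * (a₂ * v₃ - a₃ * v₂) * u₁ + g * (u₂ * a₃ - u₃ * a₂) * v₁)
    identity₁ = solve-∀
    identity₂ : ∀ g a₂ a₃ u₂ u₃ v₂ v₃ →
      a₂ - (g * (a₂ * v₃ - a₃ * v₂) * u₂ + g * (u₂ * a₃ - u₃ * a₂) * v₂)
        ≡ - a₂ * ((u₂ * v₃ - u₃ * v₂) * g - + 1)
    identity₂ = solve-∀
    identity₃ : ∀ g a₂ a₃ u₂ u₃ v₂ v₃ →
      a₃ - (g * (a₂ * v₃ - a₃ * v₂) * u₃ + g * (u₂ * a₃ - u₃ * a₂) * v₃)
        ≡ - a₃ * ((u₂ * v₃ - u₃ * v₂) * g - + 1)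
    identity₃ = solve-∀

module Subspaces (p : ℕ) .{{_ : NonZero p}} (p-prime : Prime p) (p-odd : p % 2 ≡ 1) where
  open Congruence p
  open Residues p
  open OddPrime p p-prime p-odd

  independent : ∀ {u v} → LinIndep2 p u v → Independent (ιV u) (ιV v)
  independent {u} {v} li c d h = reduced-zero c (proj₁ zeros) , reduced-zero d (proj₂ zeros)
    where
    zeros : reduce c ≡ 0F p × reduce d ≡ 0F p
    zeros = li (reduce c) (reduce d) (ιV≋0 (≋³-trans (ιV-span2-reduce c d u v) h))
    reduced-zero : ∀ z → reduce z ≡ 0F p → + p ∣ z
    reduced-zero z e = ≋0⇒∣ (≋-trans (≋-sym (ι-reduce z)) (≋-trans (≋-reflexive (cong ι e)) ι-0F))

  module Plane {u v : V p} {S : VSet p} (S≐span : _≐_ p S (span2 p u v)) where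

    n : ℤ³
    n = ιV u ⨯ ιV v

    ∈-intro : ∀ {w} c d → ιV w ≋³ c ⊙ ιV u ⊕ d ⊙ ιV v → S w
    ∈-intro c d w≋ = proj₂ (S≐span _)
      (reduce c , reduce d , ιV-injective (≋³-trans w≋ (≋³-sym (ιV-span2-reduce c d u v))))

    ∈⇒normal : ∀ {w} → S w → + p ∣ ιV w · n
    ∈⇒normal w∈S = span⇒normal (proj₁ (S≐span _) w∈S)
      where
      span⇒normal : ∀ {w} → span2 p u v w → + p ∣ ιV w · n
      span⇒normal (a , b , refl) = ∣-resp-≋ (·-cong (ιV-span2 a b u v) (≋³-refl {n}))
        (subst (+ p ∣_) (sym (span-normal (ι a) (ι b) (ιV u) (ιV v))) ∣0)

    0∈ : S (0V p)
    0∈ = ∈-intro (+ 0) (+ 0) ιV-0V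

    u∈ : S u
    u∈ = ∈-intro (+ 1) (+ 0) (≋³-reflexive (sym (span-first (ιV u) (ιV v))))

    v∈ : S v
    v∈ = ∈-intro (+ 0) (+ 1) (≋³-reflexive (sym (span-second (ιV u) (ιV v))))

    ∈image⇒quadratic : ∀ M N {w} → ιM M ≋ᴹ X N → image p M S w →
      + p ∣ coeff₀ (ιV w) n + coeff₁ (ιV w) n * N + coeff₂ (ιV w) n * N * N
    ∈image⇒quadratic M N M≋X (s , s∈S , refl) =
      subst (+ p ∣_) (act-dot-expansion N (ιV (vecMat p s M)) n)
        (∣-resp-≋ (·-cong undo-action (≋³-refl {n})) (∈⇒normal s∈S))
      where
      undo-action : act (- N) (ιV (vecMat p s M)) ≋³ ιV s
      undo-action = ≋³-trans (act-cong (- N) (action M N M≋X s)) (≋³-reflexive (act-inverse N (ιV s)))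

  0∈image : ∀ M N → ιM M ≋ᴹ X N → ∀ {S} → S (0V p) → image p M S (0V p)
  0∈image M N M≋X 0∈S = 0V p , 0∈S , ιV-injective (≋³-sym
    (≋³-trans (action M N M≋X (0V p)) (act-fixes N {ιV (0V p)} (≋0⇒∣ ι-0F) (≋0⇒∣ ι-0F))))

  ∈⟨α⟩-intro : ∀ {w} c → ιV w ≋³ c ⊙ ⟨ + 0 , + 0 , + 1 ⟩ → span1 p (α p) w
  ∈⟨α⟩-intro {w} c w≋ = reduce c , ιV-injective (≋³-trans w≋ (≋³-sym
    (≋³-trans (ιV-·V (reduce c) (α p)) (⊙-cong (ι-reduce c) ιV-α))))

  α≢0 : α p ≢ 0V p
  α≢0 α≡0 = ∤1 p-prime (≋0⇒∣ (≋-trans (≋-sym ι-1F) (≋-trans (proj₂ (proj₂ (ιV-cong α≡0))) ι-0F)))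

  ⟨α⟩-line : Dim1 p (span1 p (α p))
  ⟨α⟩-line = α p , α≢0 , λ w → (λ w∈ → w∈) , (λ w∈ → w∈)

  x-fixes-⟨α⟩ : Fixes p (xMat p) (span1 p (α p))
  x-fixes-⟨α⟩ w = (λ { (_ , (c , refl) , refl) → c , multiple-fixed c })
                , (λ { (c , refl) → _·V_ p c (α p) , (c , refl) , sym (multiple-fixed c) })
    where
    multiple-fixed : ∀ c → vecMat p (_·V_ p c (α p)) (xMat p) ≡ _·V_ p c (α p)
    multiple-fixed c = ιV-injective (≋³-trans (x-action (_·V_ p c (α p)))
      (act-fixes (+ 1) {ιV (_·V_ p c (α p))} (≋0⇒∣ (ι-*0F c)) (≋0⇒∣ (ι-*0F c))))

  fixed-line-unique : ∀ S → Dim1 p S → Fixes p (xMat p) S → _≐_ p S (span1 p (α p))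
  fixed-line-unique S (v , v≢0 , S≐span) x-fixes-S w = S⊆⟨α⟩ , ⟨α⟩⊆S
    where
    v′ : ℤ³
    v′ = ιV v
    v∈S : S v
    v∈S = proj₂ (S≐span v) (1F p , ιV-injective (≋³-sym (ιV-1·V v)))
    eigen : Σ (F p) λ c → vecMat p v (xMat p) ≡ _·V_ p c v
    eigen = proj₁ (S≐span _) (proj₁ (x-fixes-S _) (v , v∈S , refl))
    on-axis : + p ∣ π₁ v′ × + p ∣ π₂ v′
    on-axis = eigenvector-on-axis {ι (proj₁ eigen)} {v′} (≋³-trans (≋³-sym (x-action v))
      (≋³-trans (ιV-cong (proj₂ eigen)) (ιV-·V (proj₁ eigen) v)))
    p∤v₃ : ¬ + p ∣ π₃ v′
    p∤v₃ p∣v₃ = v≢0 (ιV≋0 (∣⇒≋0 (proj₁ on-axis) , ∣⇒≋0 (proj₂ on-axis) , ∣⇒≋0 p∣v₃))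
    S⊆⟨α⟩ : S w → span1 p (α p) w
    S⊆⟨α⟩ w∈S = multiple⇒∈⟨α⟩ (proj₁ (S≐span w) w∈S)
      where
      multiple⇒∈⟨α⟩ : ∀ {w} → span1 p v w → span1 p (α p) w
      multiple⇒∈⟨α⟩ (c , refl) = ∈⟨α⟩-intro (ι c * π₃ v′)
        (≋³-trans (ιV-·V c v) (⊙-on-axis (ι c) (proj₁ on-axis) (proj₂ on-axis)))
    ⟨α⟩⊆S : span1 p (α p) w → S w
    ⟨α⟩⊆S (c , refl) = proj₂ (S≐span _) (reduce (ι c * g) , ιV-injective
      (≋³-trans (ιV-·V c (α p)) (≋³-trans (⊙-cong (≋-sym (cancel-inverse (ι c) v₃g≋1)) ιV-α)
      (≋³-trans (≋³-sym (⊙-on-axis (ι c * g) {v′} (proj₁ on-axis) (proj₂ on-axis)))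
      (≋³-trans (⊙-cong (≋-sym (ι-reduce (ι c * g))) (≋³-refl {v′})) (≋³-sym (ιV-·V (reduce (ι c * g)) v)))))))
      where
      g : ℤ
      g = proj₁ (inverse p-prime p∤v₃)
      v₃g≋1 : π₃ v′ * g ≋ + 1
      v₃g≋1 = proj₂ (inverse p-prime p∤v₃)

  S'-intro : ∀ {w} → π₁ (ιV w) ≋ + 0 → S' p w
  S'-intro {a ∷ b ∷ c ∷ []} a≋0 = b , c , cong (λ t → t ∷ b ∷ c ∷ []) (ι-injective (≋-trans a≋0 (≋-sym ι-0F)))

  S'-plane : Dim2 p (S' p)
  S'-plane = u₀ , v₀ , independent₀ , λ w → S'⊆span , span⊆S'
    where
    u₀ v₀ : V p
    u₀ = 0F p ∷ 1F p ∷ 0F p ∷ []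
    v₀ = 0F p ∷ 0F p ∷ 1F p ∷ []
    span-coordinates : ∀ a b → ιV (_+V_ p (_·V_ p a u₀) (_·V_ p b v₀)) ≋³ ⟨ + 0 , ι a , ι b ⟩
    span-coordinates a b = ≋³-trans (ιV-span2 a b u₀ v₀)
      (≋³-trans (⊕-cong (⊙-cong (≋-refl {ι a}) (ι-0F , ι-1F , ι-0F)) (⊙-cong (≋-refl {ι b}) (ι-0F , ι-0F , ι-1F)))
                (coordinate-plane (ι a) (ι b)))
    independent₀ : LinIndep2 p u₀ v₀
    independent₀ a b e = ι-injective (≋-trans a≋0 (≋-sym ι-0F)) , ι-injective (≋-trans b≋0 (≋-sym ι-0F))
      where
      coordinates≋0 : ⟨ + 0 , ι a , ι b ⟩ ≋³ 0³
      coordinates≋0 = ≋³-trans (≋³-sym (span-coordinates a b)) (≋³-trans (ιV-cong e) ιV-0V)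
      a≋0 : ι a ≋ + 0
      a≋0 = proj₁ (proj₂ coordinates≋0)
      b≋0 : ι b ≋ + 0
      b≋0 = proj₂ (proj₂ coordinates≋0)
    S'⊆span : ∀ {w} → S' p w → span2 p u₀ v₀ w
    S'⊆span (a₂ , a₃ , refl) =
      a₂ , a₃ , ιV-injective (≋³-trans (ιV-S' a₂ a₃) (≋³-sym (span-coordinates a₂ a₃)))
    span⊆S' : ∀ {w} → span2 p u₀ v₀ w → S' p w
    span⊆S' (a , b , refl) = S'-intro (proj₁ (span-coordinates a b))

  x-fixes-S' : Fixes p (xMat p) (S' p)
  x-fixes-S' w = image⊆S' , S'⊆image
    where
    image⊆S' : image p (xMat p) (S' p) w → S' p w
    image⊆S' (_ , (a₂ , a₃ , refl) , refl) = S'-intro (≋-trans (proj₁ (x-action (0F p ∷ a₂ ∷ a₃ ∷ []))) ι-0F)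
    S'⊆image : S' p w → image p (xMat p) (S' p) w
    S'⊆image (a₂ , a₃ , refl) = s , (a₂ , e , refl) , ιV-injective (≋³-sym
      (≋³-trans (x-action s) (≋³-trans (act-shear {ιV s} (≋0⇒∣ ι-0F))
        (≋-refl , ≋-refl , ≋-trans (+-cong (≋-refl {+ 2 * ι a₂}) (ι-reduce _)) (≋-reflexive (identity (ι a₂) (ι a₃)))))))
      where
      e : F p
      e = reduce (ι a₃ - + 2 * ι a₂)
      s : V p
      s = 0F p ∷ a₂ ∷ e ∷ []
      identity : ∀ x y → + 2 * x + (y - + 2 * x) ≡ y
      identity = solve-∀

  fixed-plane-unique : ∀ S → Dim2 p S → Fixes p (xMat p) S → _≐_ p S (S' p)
  fixed-plane-unique S (u , v , li , S≐span) x-fixes-S w = S⊆S' , S'⊆S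
    where
    open Plane S≐span
    shift : ∀ {y} → S y → + p ∣ coeff₁ (ιV y) n + coeff₂ (ιV y) n
    shift {y} y∈S = ∣-by _ (identity (coeff₀ (ιV y) n) (coeff₁ (ιV y) n) (coeff₂ (ιV y) n))
      (∣m∣n⇒∣m-n (∈image⇒quadratic (xMat p) (+ 1) ιM-xMat (proj₂ (x-fixes-S _) y∈S)) (∈⇒normal y∈S))
      where
      identity : ∀ c₀ c₁ c₂ → c₁ + c₂ ≡ (c₀ + c₁ * + 1 + c₂ * + 1 * + 1) - c₀
      identity = solve-∀
    p∣n₂ : + p ∣ π₂ n
    p∣n₂ = proj₁ (fixed-plane-normal (ιV u) (ιV v) (shift u∈) (shift v∈))
    p∣n₃ : + p ∣ π₃ n
    p∣n₃ = proj₂ (fixed-plane-normal (ιV u) (ιV v) (shift u∈) (shift v∈))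
    p∤n₁ : ¬ + p ∣ π₁ n
    p∤n₁ p∣n₁ = independent⇒normal≉0 (independent li) (∣⇒≋0 p∣n₁ , ∣⇒≋0 p∣n₂ , ∣⇒≋0 p∣n₃)
    first-zero : ∀ {y} → S y → + p ∣ π₁ (ιV y)
    first-zero {y} y∈S = first-coordinate-zero {ιV y} {n} p∤n₁ p∣n₂ p∣n₃ (∈⇒normal y∈S)
    S⊆S' : S w → S' p w
    S⊆S' w∈S = S'-intro (∣⇒≋0 (first-zero w∈S))
    S'⊆S : S' p w → S w
    S'⊆S (a₂ , a₃ , refl) =
      ∈-intro (g * (ι a₂ * π₃ (ιV v) - ι a₃ * π₂ (ιV v))) (g * (π₂ (ιV u) * ι a₃ - π₃ (ιV u) * ι a₂))
        (≋³-trans (ιV-S' a₂ a₃) (cramer {ιV u} {ιV v} (first-zero u∈) (first-zero v∈) n₁g≋1 (ι a₂) (ι a₃)))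
      where
      g : ℤ
      g = proj₁ (inverse p-prime p∤n₁)
      n₁g≋1 : π₁ n * g ≋ + 1
      n₁g≋1 = proj₂ (inverse p-prime p∤n₁)

  triple-intersection : ∀ S → Dim2 p S → ¬ S (α p) → (i j k : Fin p) → i ≢ j → j ≢ k → i ≢ k →
    _≐_ p (_∩_ p (_∩_ p (image p (mpow p (xMat p) (toℕ i)) S) (image p (mpow p (xMat p) (toℕ j)) S))
              (image p (mpow p (xMat p) (toℕ k)) S)) (Zero p)
  triple-intersection S (u , v , li , S≐span) α∉S i j k i≢j j≢k i≢k w = ⊆Zero , Zero⊆
    where
    open Plane S≐span
    S^x^ : Fin p → VSet p
    S^x^ t = image p (mpow p (xMat p) (toℕ t)) S
    p∤n₃ : ¬ + p ∣ π₃ n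
    p∤n₃ p∣n₃ = let c , d , e₃≋ = p∣n₃⇒e₃∈span (independent li) p∣n₃ in
      α∉S (∈-intro c d (≋³-trans ιV-α e₃≋))
    distinct : ∀ {s t : Fin p} → s ≢ t → ¬ + p ∣ ι s - ι t
    distinct s≢t p∣s-t = s≢t (ι-injective (≋-intro p∣s-t))
    quadratic : ∀ t → S^x^ t w →
      + p ∣ coeff₀ (ιV w) n + coeff₁ (ιV w) n * ι t + coeff₂ (ιV w) n * ι t * ι t
    quadratic t = ∈image⇒quadratic (mpow p (xMat p) (toℕ t)) (ι t) (ιM-mpow (toℕ t))
    ⊆Zero : _∩_ p (_∩_ p (S^x^ i) (S^x^ j)) (S^x^ k) w → Zero p w
    ⊆Zero ((wᵢ , wⱼ) , wₖ) = ιV≋0 (∣⇒≋0 (proj₁ w≋0) , ∣⇒≋0 (proj₁ (proj₂ w≋0)) , ∣⇒≋0 (proj₂ (proj₂ w≋0)))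
      where
      w′ : ℤ³
      w′ = ιV w
      coefficients : + p ∣ coeff₀ w′ n × + p ∣ coeff₁ w′ n × + p ∣ coeff₂ w′ n
      coefficients = three-roots {coeff₀ w′ n} {coeff₁ w′ n} {coeff₂ w′ n} {ι i} {ι j} {ι k}
        (distinct i≢j) (distinct i≢k) (distinct j≢k) (quadratic i wᵢ) (quadratic j wⱼ) (quadratic k wₖ)
      w≋0 : + p ∣ π₁ w′ × + p ∣ π₂ w′ × + p ∣ π₃ w′
      w≋0 = triangular-zero {π₁ w′} {π₂ w′} {π₃ w′} {π₁ n} {π₂ n} {π₃ n} p∤n₃
        (∣-half p-prime p-odd (proj₂ (proj₂ coefficients)))
        (∣-half p-prime p-odd (∣-neg (proj₁ (proj₂ coefficients))))
        (proj₁ coefficients)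
    0∈S^x^ : ∀ t → S^x^ t (0V p)
    0∈S^x^ t = 0∈image (mpow p (xMat p) (toℕ t)) (ι t) (ιM-mpow (toℕ t)) 0∈
    Zero⊆ : Zero p w → _∩_ p (_∩_ p (S^x^ i) (S^x^ j)) (S^x^ k) w
    Zero⊆ refl = (0∈S^x^ i , 0∈S^x^ j) , 0∈S^x^ k

lemma4p4 : (p : ℕ) .{{_ : NonZero p}} → Prime p → p % 2 ≡ 1 →
    ((Dim1 p (span1 p (α p)) × Fixes p (xMat p) (span1 p (α p))
        × (∀ S → Dim1 p S → Fixes p (xMat p) S → _≐_ p S (span1 p (α p))))
     × (Dim2 p (S' p) × Fixes p (xMat p) (S' p)
        × (∀ S → Dim2 p S → Fixes p (xMat p) S → _≐_ p S (S' p))))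
    × (∀ S → Dim2 p S → ¬ S (α p) → (i j k : Fin p) → i ≢ j → j ≢ k → i ≢ k →
        _≐_ p (_∩_ p (_∩_ p (image p (mpow p (xMat p) (toℕ i)) S) (image p (mpow p (xMat p) (toℕ j)) S)) (image p (mpow p (xMat p) (toℕ k)) S)) (Zero p))
lemma4p4 p p-prime p-odd =
  ((⟨α⟩-line , x-fixes-⟨α⟩ , fixed-line-unique) , (S'-plane , x-fixes-S' , fixed-plane-unique)) ,
  triple-intersection
  where open Subspaces p p-prime p-odd
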